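{- For all integers $n\geq 1$ and $k\geq 2$, $$\mathrm{NC}_{n+1}^{(k)}(t)=t\sum_{i=0}^{n}\binom{n}{i}\mathrm{NW}_{i}^{(k)}(t),$$ where $\mathrm{NW}_0^{(k)}(t)=1$ by convention.
   Context: For a set partition $P$ of $[m]=\{1,\dots,m\}$, its arc diagram has nodes $1,\dots,m$ and an arc $(i,j)$, $i<j$, whenever $i,j$ lie in the same block and that block contains no $l$ with $i<l<j$ (and a loop $(i,i)$ when $\{i\}$ is a block). A $k$-crossing of $P$ is a set of $k$ arcs $(i_1,j_1),\dots,(i_k,j_k)$ of its arc diagram with $i_1<i_2<\cdots<i_k<j_1<j_2<\cdots<j_k$; a weak $k$-crossing is a set of $k$ arcs with $i_1<i_2<\cdots<i_k=j_1<j_2<\cdots<j_k$. $k$-crossings and weak $k$-crossings are together called enhanced $k$-crossings. $P$ is $k$-noncrossing if it has no $k$-crossing, and enhanced $k$-noncrossing if it has no enhanced $k$-crossing. $\mathrm{NC}_m^{(k)}(t)$ (resp. $\mathrm{NW}_m^{(k)}(t)$) is the sum of $t^{\text{number of blocks of }P}$ over all $k$-noncrossing (resp. enhanced $k$-noncrossing) partitions $P$ of $[m]$. -}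

module Defs where

open import Data.Nat using (ℕ; zero; suc; _+_; _*_; _⊔_; _<_; _≤_; _≟_; _<?_; _≤?_)
open import Data.Nat.Combinatorics using (_C_)
open import Data.Product using (_×_; _,_; proj₁; proj₂)
open import Data.Product.Relation.Binary.Pointwise.NonDependent using ()
open import Data.Sum using (_⊎_)
open import Data.Maybe using (Maybe)
import Data.Maybe.Properties as MaybeP
open import Data.List using (List; []; _∷_; _++_; map; concatMap; upTo; length; filter;
  cartesianProduct; head; last; drop)
open import Data.Nat.ListAction using (sum)
open import Data.List.Relation.Unary.All using (All; all?)
open import Data.List.Relation.Unary.Any using (Any; any?)
open import Data.List.Relation.Unary.Linked using (Linked; linked?)
open import Relation.Binary.PropositionalEquality using (_≡_; _≢_)
open import Relation.Nullary using (Dec; ¬_; ¬?)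
open import Relation.Nullary.Decidable using (_×-dec_; _⊎-dec_; _→-dec_)

-- Set partitions of [m] = {1,…,m}, encoded (canonically) as restricted
-- growth strings: a list (a₁,…,aₘ) of block labels with a₁ = 0 and
-- aₚ ≤ 1 + max(a₁,…,aₚ₋₁).  Element p lies in block number aₚ; blocks are
-- numbered in order of their least element.  This is a bijection with set
-- partitions of [m].  Each entry of 'partitions m' also records the number
-- of blocks (= 1 + max label, or 0 for m = 0).

partitions : ℕ → List (List ℕ × ℕ)
partitions zero    = ([] , 0) ∷ []
partitions (suc m) =
  concatMap (λ sb → map (λ a → (proj₁ sb ++ (a ∷ []) , proj₂ sb ⊔ suc a))
                        (upTo (suc (proj₂ sb))))
            (partitions m)

-- label of position p (1-based) in a restricted growth string
lab : List ℕ → ℕ → ℕ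
lab []       _             = 0
lab (a ∷ s)  zero          = 0
lab (a ∷ s)  (suc zero)    = a
lab (a ∷ s)  (suc (suc p)) = lab s (suc p)

nodes : ℕ → List ℕ
nodes m = map suc (upTo m)

IsArc : ℕ → List ℕ → ℕ × ℕ → Set
IsArc m s (i , j) =
    (i < j × lab s i ≡ lab s j ×
       All (λ l → i < l → l < j → lab s l ≢ lab s i) (nodes m))
  ⊎ (i ≡ j × All (λ l → l ≢ i → lab s l ≢ lab s i) (nodes m))

isArc? : ∀ m s (a : ℕ × ℕ) → Dec (IsArc m s a)
isArc? m s (i , j) =
    ((i <? j) ×-dec ((lab s i ≟ lab s j) ×-dec
       all? (λ l → (i <? l) →-dec ((l <? j) →-dec ¬? (lab s l ≟ lab s i))) (nodes m)))
  ⊎-dec ((i ≟ j) ×-dec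
       all? (λ l → ¬? (l ≟ i) →-dec ¬? (lab s l ≟ lab s i)) (nodes m))

arcs : ℕ → List ℕ → List (ℕ × ℕ)
arcs m s = filter (isArc? m s) (cartesianProduct (nodes m) (nodes m))

seqs : {A : Set} → ℕ → List A → List (List A)
seqs zero    xs = [] ∷ []
seqs (suc k) xs = concatMap (λ x → map (x ∷_) (seqs k xs)) xs

lefts rights : List (ℕ × ℕ) → List ℕ
lefts  = map proj₁
rights = map proj₂

IsCrossing : List (ℕ × ℕ) → Set
IsCrossing v = Linked _<_ (lefts v ++ rights v)

IsWeakCrossing : List (ℕ × ℕ) → Set
IsWeakCrossing v =
  Linked _<_ (lefts v ++ drop 1 (rights v)) × (last (lefts v) ≡ head (rights v))

isCrossing? : ∀ v → Dec (IsCrossing v)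
isCrossing? v = linked? _<?_ (lefts v ++ rights v)

isWeakCrossing? : ∀ v → Dec (IsWeakCrossing v)
isWeakCrossing? v = linked? _<?_ (lefts v ++ drop 1 (rights v))
  ×-dec MaybeP.≡-dec _≟_ (last (lefts v)) (head (rights v))

HasCrossing : ℕ → ℕ → List ℕ → Set
HasCrossing k m s = Any IsCrossing (seqs k (arcs m s))

HasEnhancedCrossing : ℕ → ℕ → List ℕ → Set
HasEnhancedCrossing k m s =
  Any (λ v → IsCrossing v ⊎ IsWeakCrossing v) (seqs k (arcs m s))

hasCrossing? : ∀ k m s → Dec (HasCrossing k m s)
hasCrossing? k m s = any? isCrossing? (seqs k (arcs m s))

hasEnhancedCrossing? : ∀ k m s → Dec (HasEnhancedCrossing k m s)
hasEnhancedCrossing? k m s =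
  any? (λ v → isCrossing? v ⊎-dec isWeakCrossing? v) (seqs k (arcs m s))

-- Polynomials in t with ℕ coefficients, as coefficient functions.

Poly : Set
Poly = ℕ → ℕ

tmul : Poly → Poly
tmul f zero    = 0
tmul f (suc b) = f b

NC : ℕ → ℕ → Poly
NC m k b = length (filter (λ sb → (proj₂ sb ≟ b) ×-dec ¬? (hasCrossing? k m (proj₁ sb)))
                          (partitions m))

-- NW_m^(k)(t): same for enhanced k-noncrossing partitions.
-- For m = 0 this is 1 (the empty partition, 0 blocks, no arcs) when k ≥ 1,
-- matching the convention NW_0^(k)(t) = 1.
NW : ℕ → ℕ → Poly
NW m k b = length (filter (λ sb → (proj₂ sb ≟ b) ×-dec ¬? (hasEnhancedCrossing? k m (proj₁ sb)))
                          (partitions m))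

binomNWSum : ℕ → ℕ → Poly
binomNWSum n k b = sum (map (λ i → (n C i) * NW i k b) (upTo (suc n)))

{-# OPTIONS --safe #-}

-- Replace every arc (i, j) of a partition of [n+1] by (i, j−1).  On [n] this gives the arcs of a
-- partition together with loops (q, q) coming from the arcs (q, q+1), and q then meets no other
-- arc.  A k-crossing i₁ < ⋯ < iₖ < j₁ < ⋯ < jₖ becomes i₁ < ⋯ < iₖ ≤ j₁−1 < ⋯ < jₖ−1, an enhanced
-- k-crossing, and for k ≥ 2 it involves no arc (q, q+1).  Deleting the n − i nodes carrying loops
-- therefore leaves an arbitrary enhanced k-noncrossing partition of an i-subset of [n]; it has one
-- block less, as blocks are nodes minus arcs.
--
-- Adding the nodes one at a time, in both pictures node q is joined to the last node of some block
-- or opens a block, and on the left there is one further choice, joining q+1 to q.  This extra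
-- choice is the Pascal recursion for the binomial coefficients.
module Submission where

open import Defs
open import Data.Nat using (ℕ; zero; pred; suc; _+_; _*_; _⊔_; _<_; _≤_;
  z≤n; s≤s; s<s; s<s⁻¹; _≟_; _≤?_)
open import Data.Nat.Combinatorics using (_C_; k>n⇒nCk≡0; nCk+nC[k+1]≡[n+1]C[k+1])
open import Data.Nat.ListAction using (sum)
open import Data.Nat.ListAction.Properties using (sum-++; sum-↭)
open import Data.Nat.Properties
open import Algebra.Properties.CommutativeSemigroup +-commutativeSemigroup using (interchange)
open import Data.Bool using (true; false; if_then_else_)
open import Data.List using (List; []; _∷_; _++_; _∷ʳ_; map; concatMap; upTo; length;
  filter; last; cartesianProduct)
open import Data.List.Properties hiding (sum-++)
open import Data.List.Membership.Propositional using (_∈_; find; lose)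
open import Data.List.Membership.Propositional.Properties
open import Data.List.Relation.Unary.All as All using (All; []; _∷_)
import Data.List.Relation.Unary.All.Properties as All
open import Data.List.Relation.Unary.Any using (Any; any?; here; there)
open import Data.List.Relation.Unary.AllPairs as AllPairs using (AllPairs; []; _∷_)
import Data.List.Relation.Unary.AllPairs.Properties as AllPairs
open import Data.List.Relation.Unary.Linked.Properties using (Linked⇒AllPairs; AllPairs⇒Linked)
open import Data.List.Relation.Binary.Permutation.Propositional
  using (_↭_; ↭-refl; ↭-sym; ↭-trans; prep; swap; ↭⇒↭ₛ)
open import Data.List.Relation.Binary.Permutation.Propositional.Properties
  using (All-resp-↭; ↭-length; ∷↭∷ʳ) renaming (map⁺ to ↭-map⁺)
open import Data.List.Relation.Binary.Permutation.Setoid.Properties using (Unique-resp-↭)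
open import Data.List.Relation.Unary.Unique.Propositional.Properties using (upTo⁺)
open import Data.Maybe using (just)
open import Data.Product using (_×_; _,_; proj₁; proj₂; ∃; map₂)
import Data.Product as Product
open import Data.Sum using (_⊎_; inj₁; inj₂; [_,_]′)
open import Function using (_∘_; id; _⇔_; mk⇔; case_of_)
open import Function.Bundles using (module Equivalence)
open import Relation.Binary.Definitions using (tri<; tri≈; tri>)
open import Relation.Binary.PropositionalEquality hiding ([_])
open import Relation.Nullary using (Dec; yes; no; does; ¬?; contradiction)
open import Relation.Nullary.Decidable using (_×-dec_; _⊎-dec_; does-⇔)
open import Relation.Unary using (Decidable)

open Equivalence using (to; from)

private variable
  A B : Set

-- Finite sums and binomial sums.

∑ : List A → (A → ℕ) → ℕ
∑ xs f = sum (map f xs)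

∑-cong : {xs : List A} {f g : A → ℕ} → All (λ x → f x ≡ g x) xs → ∑ xs f ≡ ∑ xs g
∑-cong = cong sum ∘ map-cong-local

∑-map : (h : A → B) (f : B → ℕ) (xs : List A) → ∑ (map h xs) f ≡ ∑ xs (f ∘ h)
∑-map h f xs = cong sum (sym (map-∘ xs))

∑-concatMap : (h : A → List B) (f : B → ℕ) (xs : List A) →
  ∑ (concatMap h xs) f ≡ ∑ xs (λ x → ∑ (h x) f)
∑-concatMap h f []       = refl
∑-concatMap h f (x ∷ xs) = begin
  sum (map f (h x ++ concatMap h xs))        ≡⟨ cong sum (map-++ f (h x) _) ⟩
  sum (map f (h x) ++ map f (concatMap h xs)) ≡⟨ sum-++ (map f (h x)) _ ⟩
  ∑ (h x) f + ∑ (concatMap h xs) f           ≡⟨ cong (∑ (h x) f +_) (∑-concatMap h f xs) ⟩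
  ∑ (h x) f + ∑ xs (λ x → ∑ (h x) f)         ∎
  where open ≡-Reasoning

indicator : {P : Set} → Dec P → ℕ
indicator P? = if does P? then 1 else 0

indicator-cong : {P Q : Set} → P ⇔ Q → (P? : Dec P) (Q? : Dec Q) → indicator P? ≡ indicator Q?
indicator-cong P⇔Q P? Q? = cong (if_then 1 else 0) (does-⇔ P⇔Q P? Q?)

length-filter-∑ : {P : A → Set} (P? : Decidable P) (xs : List A) →
  length (filter P? xs) ≡ ∑ xs (indicator ∘ P?)
length-filter-∑ P? []       = refl
length-filter-∑ P? (x ∷ xs) with does (P? x)
... | true  = cong suc (length-filter-∑ P? xs)
... | false = length-filter-∑ P? xs

-- The sum of `(n C i) * f i` over `i ≤ n`, in the form of Pascal's recursion, so that adding one
-- node unfolds it once.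
binomialSum : ℕ → (ℕ → ℕ) → ℕ
binomialSum zero    f = f 0
binomialSum (suc n) f = binomialSum n f + binomialSum n (f ∘ suc)

binomialSum-cong : ∀ n {f g : ℕ → ℕ} → f ≗ g → binomialSum n f ≡ binomialSum n g
binomialSum-cong zero    f≗g = f≗g 0
binomialSum-cong (suc n) f≗g =
  cong₂ _+_ (binomialSum-cong n f≗g) (binomialSum-cong n (f≗g ∘ suc))

binomialSum-+ : ∀ n (f g : ℕ → ℕ) →
  binomialSum n (λ i → f i + g i) ≡ binomialSum n f + binomialSum n g
binomialSum-+ zero    f g = refl
binomialSum-+ (suc n) f g = trans
  (cong₂ _+_ (binomialSum-+ n f g) (binomialSum-+ n (f ∘ suc) (g ∘ suc)))
  (interchange (binomialSum n f) (binomialSum n g) _ _)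

binomialSum-0 : ∀ n → binomialSum n (λ _ → 0) ≡ 0
binomialSum-0 zero    = refl
binomialSum-0 (suc n) = cong₂ _+_ (binomialSum-0 n) (binomialSum-0 n)

binomialSum-∑ : ∀ n (f : A → ℕ → ℕ) (xs : List A) →
  binomialSum n (λ i → ∑ xs (λ x → f x i)) ≡ ∑ xs (λ x → binomialSum n (f x))
binomialSum-∑ n f []       = binomialSum-0 n
binomialSum-∑ n f (x ∷ xs) = trans
  (binomialSum-+ n (f x) _)
  (cong (binomialSum n (f x) +_) (binomialSum-∑ n f xs))

∑-upTo-suc : ∀ n (f : ℕ → ℕ) → ∑ (upTo (suc n)) f ≡ f 0 + ∑ (upTo n) (f ∘ suc)
∑-upTo-suc n f = cong (λ xs → f 0 + sum xs)
  (trans (map-applyUpTo suc f n) (sym (map-upTo (f ∘ suc) n)))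

∑-upTo-∷ʳ : ∀ n (f : ℕ → ℕ) → ∑ (upTo (suc n)) f ≡ ∑ (upTo n) f + f n
∑-upTo-∷ʳ n f = begin
  ∑ (upTo (suc n)) f              ≡⟨ cong (λ xs → ∑ xs f) (sym (upTo-∷ʳ n)) ⟩
  ∑ (upTo n ∷ʳ n) f               ≡⟨ cong sum (map-++ f (upTo n) _) ⟩
  sum (map f (upTo n) ++ f n ∷ []) ≡⟨ sum-++ (map f (upTo n)) _ ⟩
  ∑ (upTo n) f + (f n + 0)        ≡⟨ cong (∑ (upTo n) f +_) (+-identityʳ (f n)) ⟩
  ∑ (upTo n) f + f n              ∎
  where open ≡-Reasoning

∑-+ : (f g : A → ℕ) (xs : List A) → ∑ xs (λ x → f x + g x) ≡ ∑ xs f + ∑ xs g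
∑-+ f g []       = refl
∑-+ f g (x ∷ xs) = trans
  (cong (f x + g x +_) (∑-+ f g xs))
  (interchange (f x) (g x) (∑ xs f) (∑ xs g))

-- Pascal's rule splits every term but the one at 0. One half, with the term at 0, is the sum for
-- `n` plus a top term; the other is the sum for `n` and `f ∘ suc`.
binomialSum-∑C : ∀ n (f : ℕ → ℕ) → ∑ (upTo (suc n)) (λ i → (n C i) * f i) ≡ binomialSum n f
binomialSum-∑C zero    f = trans (+-identityʳ _) (+-identityʳ (f 0))
binomialSum-∑C (suc n) f = begin
  ∑ (upTo (2 + n)) (λ i → (suc n C i) * f i)
    ≡⟨ ∑-upTo-suc (suc n) (λ i → (suc n C i) * f i) ⟩
  1 * f 0 + ∑ (upTo (suc n)) (λ i → (suc n C suc i) * f (suc i))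
    ≡⟨ cong (1 * f 0 +_) (cong sum (map-cong (λ i → trans
         (cong (_* f (suc i)) (sym (nCk+nC[k+1]≡[n+1]C[k+1] n i)))
         (trans (*-distribʳ-+ (f (suc i)) (n C i) _) (+-comm ((n C i) * f (suc i)) _)))
         (upTo (suc n)))) ⟩
  1 * f 0 + ∑ (upTo (suc n)) (λ i → (n C suc i) * f (suc i) + (n C i) * f (suc i))
    ≡⟨ cong (1 * f 0 +_) (∑-+ (λ i → (n C suc i) * f (suc i)) (λ i → (n C i) * f (suc i)) (upTo (suc n))) ⟩
  1 * f 0 + (∑ (upTo (suc n)) (λ i → (n C suc i) * f (suc i)) +
             ∑ (upTo (suc n)) (λ i → (n C i) * f (suc i)))
    ≡⟨ +-assoc (1 * f 0) _ _ ⟨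
  1 * f 0 + ∑ (upTo (suc n)) (λ i → (n C suc i) * f (suc i)) +
    ∑ (upTo (suc n)) (λ i → (n C i) * f (suc i))
    ≡⟨ cong₂ _+_ (sym (∑-upTo-suc (suc n) (λ i → (n C i) * f i)))
                 (binomialSum-∑C n (f ∘ suc)) ⟩
  ∑ (upTo (2 + n)) (λ i → (n C i) * f i) + binomialSum n (f ∘ suc)
    ≡⟨ cong (_+ binomialSum n (f ∘ suc)) (∑-upTo-∷ʳ (suc n) (λ i → (n C i) * f i)) ⟩
  ∑ (upTo (suc n)) (λ i → (n C i) * f i) + (n C suc n) * f (suc n) + binomialSum n (f ∘ suc)
    -- The top term has coefficient `n C suc n`, which is 0.
    ≡⟨ cong (_+ binomialSum n (f ∘ suc)) (cong₂ _+_ (binomialSum-∑C n f)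
         (cong (_* f (suc n)) (k>n⇒nCk≡0 (n<1+n n)))) ⟩
  binomialSum n f + 0 + binomialSum n (f ∘ suc)
    ≡⟨ cong (_+ binomialSum n (f ∘ suc)) (+-identityʳ (binomialSum n f)) ⟩
  binomialSum n f + binomialSum n (f ∘ suc) ∎
  where open ≡-Reasoning

-- Growing a partition by its arcs

select : List A → List (A × List A)
select []       = []
select (x ∷ xs) = (x , xs) ∷ map (map₂ (x ∷_)) (select xs)

select-↭ : (xs : List A) → All (λ (x , rest) → x ∷ rest ↭ xs) (select xs)
select-↭ []       = []
select-↭ (x ∷ xs) = ↭-refl ∷
  All.map⁺ (All.map (λ p → ↭-trans (swap _ _ ↭-refl) (prep x p)) (select-↭ xs))

select-map : (f : A → B) (xs : List A) →
  select (map f xs) ≡ map (Product.map f (map f)) (select xs)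
select-map f []       = refl
select-map f (x ∷ xs) = cong ((f x , map f xs) ∷_) (begin
  map (map₂ (f x ∷_)) (select (map f xs))                    ≡⟨ cong (map _) (select-map f xs) ⟩
  map (map₂ (f x ∷_)) (map (Product.map f (map f)) (select xs)) ≡⟨ map-∘ (select xs) ⟨
  map (Product.map f (map f) ∘ map₂ (x ∷_)) (select xs)      ≡⟨ map-∘ (select xs) ⟩
  map (Product.map f (map f)) (map (map₂ (x ∷_)) (select xs)) ∎)
  where open ≡-Reasoning

map-proj₁-select : (xs : List A) → map proj₁ (select xs) ≡ xs
map-proj₁-select []       = refl
map-proj₁-select (x ∷ xs) = cong (x ∷_) (trans (sym (map-∘ (select xs))) (map-proj₁-select xs))

Arc : Set
Arc = ℕ × ℕ

-- On the nodes 1,…,p, the list `as` holds the arcs drawn so far and `ends` the last nodes of the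
-- blocks; r further nodes are to come, and F is summed over the outcomes.
growths : (List Arc → ℕ → ℕ) → ℕ → ℕ → List Arc → List ℕ → ℕ
growths F zero    p as ends = F as (length ends)
growths F (suc r) p as ends =
  growths F r (suc p) as (suc p ∷ ends) +
  ∑ (select ends) (λ (e , rest) → growths F r (suc p) ((e , suc p) ∷ as) (suc p ∷ rest))

relabel : (ℕ → ℕ) → List Arc → List Arc
relabel f = map (Product.map f f)

-- By the last hypothesis `f` carries the nodes still to come after `p` to those after `q`, so each
-- step of the growth from `q` is the image of a step from `p`.
growths-relabel : ∀ F (f : ℕ → ℕ) → (∀ as ℓ → F (relabel f as) ℓ ≡ F as ℓ) →
  ∀ r {p q} as ends → (∀ j → f (suc j + p) ≡ suc j + q) →
  growths F r q (relabel f as) (map f ends) ≡ growths F r p as ends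
growths-relabel F f inv zero    as ends shift =
  trans (inv as _) (cong (F as) (length-map f ends))
growths-relabel F f inv (suc r) {p} {q} as ends shift = cong₂ _+_
  (step as ends)
  (begin
    ∑ (select (map f ends)) (λ (e , rest) →
        growths F r (suc q) ((e , suc q) ∷ relabel f as) (suc q ∷ rest))
      ≡⟨ cong (λ xs → ∑ xs (λ (e , rest) →
           growths F r (suc q) ((e , suc q) ∷ relabel f as) (suc q ∷ rest))) (select-map f ends) ⟩
    _ ≡⟨ ∑-map (Product.map f (map f)) _ (select ends) ⟩
    _ ≡⟨ ∑-cong (All.universal (λ (e , rest) → trans
           (cong (λ x → growths F r (suc q) ((f e , x) ∷ relabel f as) (suc q ∷ map f rest))
                 (sym (shift 0)))
           (step ((e , suc p) ∷ as) rest)) (select ends)) ⟩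
    ∑ (select ends) (λ (e , rest) → growths F r (suc p) ((e , suc p) ∷ as) (suc p ∷ rest)) ∎)
  where
  open ≡-Reasoning
  step : ∀ as xs → growths F r (suc q) (relabel f as) (suc q ∷ map f xs) ≡
                   growths F r (suc p) as (suc p ∷ xs)
  step as xs = trans
    (cong (λ x → growths F r (suc q) (relabel f as) (x ∷ map f xs)) (sym (shift 0)))
    (growths-relabel F f inv r as (suc p ∷ xs)
      (λ j → trans (cong (f ∘ suc) (+-suc j p)) (trans (shift (suc j)) (cong suc (sym (+-suc j q))))))

bump : ℕ → ℕ → ℕ
bump p x with x ≤? p
... | yes _ = x
... | no _  = suc x

bump-≤ : ∀ {p x} → x ≤ p → bump p x ≡ x
bump-≤ {p} {x} x≤p with x ≤? p
... | yes _   = refl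
... | no x≰p = contradiction x≤p x≰p

bump-> : ∀ {p x} → p < x → bump p x ≡ suc x
bump-> {p} {x} p<x with x ≤? p
... | yes x≤p = contradiction x≤p (<⇒≱ p<x)
... | no _    = refl

bump-mono-< : ∀ p {x y} → x < y → bump p x < bump p y
bump-mono-< p {x} {y} x<y with x ≤? p | y ≤? p
... | yes _   | yes _   = x<y
... | yes _   | no _    = m<n⇒m<1+n x<y
... | no x≰p  | yes y≤p = contradiction (≤-trans (<⇒≤ x<y) y≤p) x≰p
... | no _    | no _    = s<s x<y

Bounded : ℕ → List Arc → Set
Bounded p = All (λ (i , j) → i ≤ p × j ≤ p)

RelabelInvariant : (List Arc → ℕ → ℕ) → Set
RelabelInvariant F = ∀ f → (∀ {x y} → x < y → f x < f y) → ∀ as ℓ → F (relabel f as) ℓ ≡ F as ℓ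

growths-start : ∀ F → RelabelInvariant F → ∀ r {p} {as ends} → Bounded p as → All (_≤ p) ends →
  growths F r (suc p) as ends ≡ growths F r p as ends
growths-start F inv r {p} {as} {ends} as≤p ends≤p = begin
  growths F r (suc p) as ends
    ≡⟨ cong₂ (growths F r (suc p))
         (sym (map-id-local (All.map (λ (i≤p , j≤p) → cong₂ _,_ (bump-≤ i≤p) (bump-≤ j≤p)) as≤p)))
         (sym (map-id-local (All.map bump-≤ ends≤p))) ⟩
  growths F r (suc p) (relabel (bump p) as) (map (bump p) ends)
    ≡⟨ growths-relabel F (bump p) (inv (bump p) (bump-mono-< p)) r as ends
         (λ j → trans (bump-> (s≤s (m≤n+m p j))) (sym (+-suc (suc j) p))) ⟩
  growths F r p as ends ∎
  where open ≡-Reasoning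

-- `skip` deletes an arc that would become a loop, `keep` moves a right endpoint down by one. The
-- surviving nodes are not renumbered.
data Reduces : List Arc → List Arc → Set where
  []   : Reduces [] []
  skip : ∀ {as′ as} i → Reduces as′ as → Reduces ((i , suc i) ∷ as′) as
  keep : ∀ {as′ as} i j → Reduces as′ as → Reduces ((i , suc j) ∷ as′) ((i , j) ∷ as)

-- The left side is one node ahead, and its newest node `suc p` ends a block. Its node `2 + p` and
-- node `suc p` on the right are placed together: opening matches opening, joining `e` in `ends`
-- matches joining `e`, and joining `suc p` matches deletion. Deletion takes none of the `i` nodes
-- to come on the right, the other choices take one; these are the two summands of
-- `binomialSum (suc r)`.
growths-reduce : ∀ F′ F → (∀ {as′ as} → Reduces as′ as → ∀ ℓ → F′ as′ (suc ℓ) ≡ F as ℓ) →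
  RelabelInvariant F → ∀ r {p as′ as ends} → Reduces as′ as → Bounded p as → All (_≤ p) ends →
  growths F′ r (suc p) as′ (suc p ∷ ends) ≡ binomialSum r (λ i → growths F i p as ends)
growths-reduce F′ F F′≡F inv zero    red as≤p ends≤p = F′≡F red _
growths-reduce F′ F F′≡F inv (suc r) {p} {as′} {as} {ends} red as≤p ends≤p = begin
  -- The first choice in `select (suc p ∷ ends)` is `suc p` itself, which gives `skip′`.
  open′ + (skip′ + ∑ (map (map₂ (suc p ∷_)) (select ends)) join′)
    ≡⟨ cong (λ z → open′ + (skip′ + z)) (∑-map (map₂ (suc p ∷_)) join′ (select ends)) ⟩
  open′ + (skip′ + ∑ (select ends) (join′ ∘ map₂ (suc p ∷_)))
    ≡⟨ cong₂ _+_
        (growths-reduce F′ F F′≡F inv r red as≤1+p (≤-refl ∷ ends≤1+p))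
        (cong₂ _+_
          (growths-reduce F′ F F′≡F inv r (skip (suc p) red) as≤1+p ends≤1+p)
          (∑-cong (All.map (λ { {e , rest} e∷rest↭ends →
            case All-resp-↭ (↭-sym e∷rest↭ends) ends≤1+p of λ { (e≤ ∷ rest≤) →
              growths-reduce F′ F F′≡F inv r (keep e (suc p) red)
                ((e≤ , ≤-refl) ∷ as≤1+p) (≤-refl ∷ rest≤) } })
            (select-↭ ends)))) ⟩
  ∑open + (∑skip + ∑ (select ends) (λ x → binomialSum r (λ i → join i x)))
    ≡⟨ cong (λ z → ∑open + (∑skip + z)) (binomialSum-∑ r (λ x i → join i x) (select ends)) ⟨
  ∑open + (∑skip + binomialSum r (λ i → ∑ (select ends) (join i)))
    ≡⟨ +-assoc ∑open ∑skip _ ⟨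
  ∑open + ∑skip + binomialSum r (λ i → ∑ (select ends) (join i))
    ≡⟨ cong (_+ binomialSum r (λ i → ∑ (select ends) (join i))) (+-comm ∑open ∑skip) ⟩
  ∑skip + ∑open + binomialSum r (λ i → ∑ (select ends) (join i))
    ≡⟨ +-assoc ∑skip ∑open _ ⟩
  ∑skip + (∑open + binomialSum r (λ i → ∑ (select ends) (join i)))
    -- In the deletion branch nothing is drawn at `suc p`, so the growth on the right may restart
    -- from `p`.
    ≡⟨ cong₂ _+_
        (binomialSum-cong r (λ i → growths-start F inv i as≤p ends≤p))
        (sym (binomialSum-+ r (λ i → growths F i (suc p) as (suc p ∷ ends)) _)) ⟩
  binomialSum (suc r) (λ i → growths F i p as ends) ∎
  where
  open ≡-Reasoning
  open′ skip′ ∑open ∑skip : ℕ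
  open′ = growths F′ r (2 + p) as′ (2 + p ∷ suc p ∷ ends)
  skip′ = growths F′ r (2 + p) ((suc p , 2 + p) ∷ as′) (2 + p ∷ ends)
  ∑open = binomialSum r (λ i → growths F i (suc p) as (suc p ∷ ends))
  ∑skip = binomialSum r (λ i → growths F i (suc p) as ends)
  join′ : ℕ × List ℕ → ℕ
  join′ (e , rest) = growths F′ r (2 + p) ((e , 2 + p) ∷ as′) (2 + p ∷ rest)
  join : ℕ → ℕ × List ℕ → ℕ
  join i (e , rest) = growths F i (suc p) ((e , suc p) ∷ as) (suc p ∷ rest)
  as≤1+p = All.map (λ (i≤p , j≤p) → m≤n⇒m≤1+n i≤p , m≤n⇒m≤1+n j≤p) as≤p
  ends≤1+p = All.map m≤n⇒m≤1+n ends≤p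

-- Crossings

∈-seqs⁻ : ∀ k {xs v : List A} → v ∈ seqs k xs → length v ≡ k × All (_∈ xs) v
∈-seqs⁻ zero    (here refl) = refl , []
∈-seqs⁻ (suc k) {xs} v∈
  with x , x∈xs , v∈′ ← find (∈-concatMap⁻ (λ x → map (x ∷_) (seqs k xs)) {xs = xs} v∈)
  with w , w∈ , refl ← ∈-map⁻ (x ∷_) v∈′
  with |w|≡k , w⊆xs ← ∈-seqs⁻ k w∈
  = cong suc |w|≡k , x∈xs ∷ w⊆xs

∈-seqs⁺ : {xs v : List A} → All (_∈ xs) v → v ∈ seqs (length v) xs
∈-seqs⁺ []             = here refl
∈-seqs⁺ (x∈xs ∷ w⊆xs) =
  ∈-concatMap⁺ _ (lose x∈xs (∈-map⁺ (_ ∷_) (∈-seqs⁺ w⊆xs)))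

-- Crossings can now be carried from one arc list to another one sequence at a time, using
-- membership only.
any-seqs : ∀ k {P Q : List A → Set} {xs ys : List A} →
  (∀ v → length v ≡ k → All (_∈ xs) v → P v →
     ∃ λ w → length w ≡ k × All (_∈ ys) w × Q w) →
  Any P (seqs k xs) → Any Q (seqs k ys)
any-seqs k P⇒Q any with v , v∈ , Pv ← find any
                   with |v|≡k , v⊆xs ← ∈-seqs⁻ k v∈
                   with w , refl , w⊆ys , Qw ← P⇒Q v |v|≡k v⊆xs Pv
                   = lose (∈-seqs⁺ w⊆ys) Qw

-- On at least two arcs, Cross 0 and Cross 1 are k-crossings and enhanced k-crossings: because the
-- endpoints increase, it suffices to compare them two arcs at a time.
Cross : ℕ → List Arc → Set
Cross d = AllPairs (λ (i , j) (i′ , j′) → i < i′ × j < j′ × i′ < d + j)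

AllPairs-++⁻ : {R : A → A → Set} (xs : List A) {ys : List A} → AllPairs R (xs ++ ys) →
  AllPairs R xs × All (λ x → All (R x) ys) xs × AllPairs R ys
AllPairs-++⁻ []       ys       = [] , [] , ys
AllPairs-++⁻ (x ∷ xs) (h ∷ t) with xs-pairs , between , ys-pairs ← AllPairs-++⁻ xs t =
  All.++⁻ˡ xs h ∷ xs-pairs , All.++⁻ʳ xs h ∷ between , ys-pairs

cross⁺ : ∀ d v → AllPairs _<_ (lefts v) → AllPairs _<_ (rights v) →
  All (λ i → All (λ j → i < d + j) (rights v)) (lefts v) → Cross d v
cross⁺ d []      []       []       []       = []
cross⁺ d (p ∷ v) (l ∷ ls) (r ∷ rs) (_ ∷ bs) =
  All.zip (All.map⁻ l , All.zip (All.map⁻ r , All.map⁻ (All.map All.head bs))) ∷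
  cross⁺ d v ls rs (All.map All.tail bs)

cross-lefts : ∀ {d v} → Cross d v → AllPairs _<_ (lefts v)
cross-lefts = AllPairs.map⁺ ∘ AllPairs.map proj₁

cross-rights : ∀ {d v} → Cross d v → AllPairs _<_ (rights v)
cross-rights = AllPairs.map⁺ ∘ AllPairs.map (proj₁ ∘ proj₂)

-- For the left endpoint of `p` itself a second arc is needed: it starts later, yet below
-- `d + proj₂ p`.
cross-lefts<first : ∀ d {p v} → 1 ≤ length v → Cross d (p ∷ v) →
  All (_< d + proj₂ p) (lefts (p ∷ v))
cross-lefts<first d {v = _ ∷ _} _ (h@((i<i′ , _ , i′<j) ∷ _) ∷ _) =
  <-trans i<i′ i′<j ∷ All.map⁺ (All.map (proj₂ ∘ proj₂) h)

first≤rights : ∀ {x : ℕ} {xs} → AllPairs _<_ (x ∷ xs) → All (x ≤_) (x ∷ xs)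
first≤rights (h ∷ _) = ≤-refl ∷ All.map <⇒≤ h

-- The first arc encloses the start of the second, and each later arc starts below `d + j` for the
-- first `j` and ends beyond that `j`. For `d = 0` this excludes arcs `(q , suc q)`, for `d = 1`
-- loops.
cross-length : ∀ d v → 2 ≤ length v → Cross d v → All (λ (i , j) → suc i < d + j) v
cross-length d (p ∷ v@(_ ∷ _)) (s≤s _) (h@((i<i′ , _ , i′<j) ∷ _) ∷ _) =
  ≤-<-trans i<i′ i′<j ∷
  All.map (λ (_ , j<j′ , i′<j) → ≤-<-trans i′<j (+-monoʳ-< d j<j′)) h

crossing⇔ : ∀ v → 2 ≤ length v → IsCrossing v ⇔ Cross 0 v
crossing⇔ (p ∷ v@(_ ∷ _)) (s≤s |v|≥1) = mk⇔
  (λ linked → let ls , between , rs = AllPairs-++⁻ (lefts (p ∷ v)) (Linked⇒AllPairs <-trans linked)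
              in cross⁺ 0 (p ∷ v) ls rs between)
  -- The first right endpoint is the smallest, so the left endpoints need comparison with it alone.
  (λ c → AllPairs⇒Linked (AllPairs.++⁺ (cross-lefts c) (cross-rights c)
    (All.map (λ i<j → All.map (<-≤-trans i<j) (first≤rights (cross-rights c)))
             (cross-lefts<first 0 |v|≥1 c))))

last-∈ : (xs : List A) {y : A} → last xs ≡ just y → y ∈ xs
last-∈ (x ∷ [])     refl = here refl
last-∈ (_ ∷ xs@(_ ∷ _)) eq   = there (last-∈ xs eq)

last-∷ : (x : A) (xs : List A) → ∃ λ y → last (x ∷ xs) ≡ just y
last-∷ x []       = x , refl
last-∷ x (y ∷ xs) = last-∷ y xs

≤-last : ∀ {xs y} → AllPairs _<_ xs → last xs ≡ just y → All (_≤ y) xs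
≤-last {_ ∷ []}     _        refl = ≤-refl ∷ []
≤-last {_ ∷ xs@(_ ∷ _)} (h ∷ t) eq = <⇒≤ (All.lookup h (last-∈ xs eq)) ∷ ≤-last t eq

-- `Cross 1` says that the last left endpoint is at most the first right endpoint. Strict inequality
-- gives a crossing, equality a weak crossing.
enhanced⇔ : ∀ v → 2 ≤ length v → (IsCrossing v ⊎ IsWeakCrossing v) ⇔ Cross 1 v
enhanced⇔ (p@(i , j) ∷ v@(q ∷ w)) |pv|≥2@(s≤s |v|≥1) = mk⇔
  [ AllPairs.map (λ (i<i′ , j<j′ , i′<j) → i<i′ , j<j′ , m<n⇒m<1+n i′<j) ∘ to (crossing⇔ (p ∷ v) |pv|≥2)
  , weak⁺ ]′
  enhanced⁻
  where
  weak⁺ : IsWeakCrossing (p ∷ v) → Cross 1 (p ∷ v)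
  weak⁺ (linked , last≡) =
    let ls , between , rs = AllPairs-++⁻ (lefts (p ∷ v)) (Linked⇒AllPairs <-trans linked)
        -- The dropped first right endpoint equals the last left endpoint, which lies before all
        -- remaining right endpoints.
        rs′ = All.lookup between (last-∈ (lefts (p ∷ v)) last≡) ∷ rs
    in cross⁺ 1 (p ∷ v) ls rs′
         (All.map (λ i≤j → All.map (λ j≤ → s≤s (≤-trans i≤j j≤)) (first≤rights rs′))
                  (≤-last ls last≡))

  enhanced⁻ : Cross 1 (p ∷ v) → IsCrossing (p ∷ v) ⊎ IsWeakCrossing (p ∷ v)
  enhanced⁻ c with y , last≡y ← last-∷ i (lefts v)
              with ls≤y ← ≤-last (cross-lefts c) last≡y
              with m≤n⇒m<n∨m≡n (≤-pred (All.lookup (cross-lefts<first 1 |v|≥1 c) (last-∈ (lefts (p ∷ v)) last≡y)))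
  ... | inj₁ y<j  = inj₁ (AllPairs⇒Linked (AllPairs.++⁺ (cross-lefts c) (cross-rights c)
          (All.map (λ i≤y → All.map (<-≤-trans (≤-<-trans i≤y y<j)) (first≤rights (cross-rights c))) ls≤y)))
  ... | inj₂ refl = inj₂ (AllPairs⇒Linked (AllPairs.++⁺ (cross-lefts c) (AllPairs.tail (cross-rights c))
          (All.map (λ i≤y → All.map (≤-<-trans i≤y) (AllPairs.head (cross-rights c))) ls≤y)) , last≡y)

-- Crossings under relabelling and reduction.

Detects : ℕ → (List Arc → Set) → Set
Detects d P = ∀ v → 2 ≤ length v → P v ⇔ Cross d v

-- The contribution of one partition with `ℓ` blocks to the coefficient at exponent `b`.
weight : {P : List Arc → Set} → Decidable P → ℕ → ℕ → List Arc → ℕ → ℕ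
weight P? k b as ℓ = indicator ((ℓ ≟ b) ×-dec ¬? (any? P? (seqs k as)))

weight-cong : {P Q : List Arc → Set} (P? : Decidable P) (Q? : Decidable Q) → ∀ k b b′ ℓ ℓ′ {as as′} →
  (ℓ ≡ b ⇔ ℓ′ ≡ b′) → (Any P (seqs k as) → Any Q (seqs k as′)) →
  (Any Q (seqs k as′) → Any P (seqs k as)) →
  weight P? k b as ℓ ≡ weight Q? k b′ as′ ℓ′
weight-cong P? Q? k b b′ ℓ ℓ′ {as} {as′} ℓ⇔ P⇒Q Q⇒P = indicator-cong
  (mk⇔ (λ (ℓ≡b , ¬P) → to ℓ⇔ ℓ≡b , λ Q → ¬P (Q⇒P Q))
       (λ (ℓ′≡b′ , ¬Q) → from ℓ⇔ ℓ′≡b′ , λ P → ¬Q (P⇒Q P)))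
  ((ℓ ≟ b) ×-dec ¬? (any? P? (seqs k as))) ((ℓ′ ≟ b′) ×-dec ¬? (any? Q? (seqs k as′)))

All-∈-map⁻ : (f : A → B) {xs : List A} {ys : List B} → All (_∈ map f xs) ys →
  ∃ λ zs → ys ≡ map f zs × All (_∈ xs) zs
All-∈-map⁻ f []           = [] , refl , []
All-∈-map⁻ f (y∈ ∷ ys⊆) with x , x∈ , refl ← ∈-map⁻ f y∈ | zs , refl , zs⊆ ← All-∈-map⁻ f ys⊆ =
  x ∷ zs , refl , x∈ ∷ zs⊆

module _ {f : ℕ → ℕ} (f-mono : ∀ {x y} → x < y → f x < f y) where

  mono-cancel-< : ∀ {x y} → f x < f y → x < y
  mono-cancel-< {x} {y} fx<fy with <-cmp x y
  ... | tri< x<y _ _    = x<y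
  ... | tri≈ _ refl _   = contradiction fx<fy (<-irrefl refl)
  ... | tri> _ _ y<x    = contradiction fx<fy (<-asym (f-mono y<x))

  mono-≤ : ∀ {x y} → x ≤ y → f x ≤ f y
  mono-≤ x≤y with m≤n⇒m<n∨m≡n x≤y
  ... | inj₁ x<y  = <⇒≤ (f-mono x<y)
  ... | inj₂ refl = ≤-refl

  mono-cancel-≤ : ∀ {x y} → f x ≤ f y → x ≤ y
  mono-cancel-≤ fx≤fy = ≮⇒≥ (λ y<x → <⇒≱ (f-mono y<x) fx≤fy)

  cross1-relabel : ∀ {v} → Cross 1 v → Cross 1 (relabel f v)
  cross1-relabel = AllPairs.map⁺ ∘ AllPairs.map λ (i<i′ , j<j′ , i′≤j) →
    f-mono i<i′ , f-mono j<j′ , s≤s (mono-≤ (≤-pred i′≤j))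

  cross1-relabel⁻ : ∀ {v} → Cross 1 (relabel f v) → Cross 1 v
  cross1-relabel⁻ = AllPairs.map (λ (i<i′ , j<j′ , i′≤j) →
    mono-cancel-< i<i′ , mono-cancel-< j<j′ , s≤s (mono-cancel-≤ (≤-pred i′≤j))) ∘ AllPairs.map⁻

module _ {P : List Arc → Set} (P? : Decidable P) (detects : Detects 1 P) {k} (2≤k : 2 ≤ k) where

  -- A strictly increasing map preserves and reflects both orders that occur in `Cross 1`, so
  -- crossings can be pushed forward and pulled back.
  weight-relabel : ∀ b → RelabelInvariant (weight P? k b)
  weight-relabel b f f-mono as ℓ = weight-cong P? P? k b b ℓ ℓ (mk⇔ id id)
    (any-seqs k λ v |v|≡k v⊆ Pv → case All-∈-map⁻ _ v⊆ of λ { (w , refl , w⊆) →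
      let |w|≡k = trans (sym (length-map _ w)) |v|≡k
          2≤|w| = subst (2 ≤_) (sym |w|≡k) 2≤k
          2≤|v| = subst (2 ≤_) (sym |v|≡k) 2≤k
      in w , |w|≡k , w⊆ ,
         from (detects w 2≤|w|) (cross1-relabel⁻ f-mono (to (detects _ 2≤|v|) Pv)) })
    (any-seqs k λ { v refl v⊆ Pv →
      relabel f v , length-map _ v , All.map⁺ (All.map (∈-map⁺ _) v⊆) ,
      from (detects _ (subst (2 ≤_) (sym (length-map _ v)) 2≤k))
           (cross1-relabel f-mono (to (detects v 2≤k) Pv)) })

-- Only arcs between consecutive nodes are skipped, so a longer arc survives.
reduces-∈ : ∀ {as′ as i j} → Reduces as′ as → (i , j) ∈ as′ → suc i < j → (i , pred j) ∈ as
reduces-∈ (skip i red)   (here refl) i<j = contradiction i<j (<-irrefl refl)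
reduces-∈ (skip i red)   (there a∈)  i<j = reduces-∈ red a∈ i<j
reduces-∈ (keep i j red) (here refl) i<j = here refl
reduces-∈ (keep i j red) (there a∈)  i<j = there (reduces-∈ red a∈ i<j)

reduces-∈⁻ : ∀ {as′ as i j} → Reduces as′ as → (i , j) ∈ as → (i , suc j) ∈ as′
reduces-∈⁻ (skip i red)   a∈          = there (reduces-∈⁻ red a∈)
reduces-∈⁻ (keep i j red) (here refl) = here refl
reduces-∈⁻ (keep i j red) (there a∈)  = there (reduces-∈⁻ red a∈)

-- The condition `i′ < 1 + j` before the shift is literally `i′ < suc j` after it.
cross-shift : ∀ {v} → Cross 1 v → Cross 0 (map (map₂ suc) v)
cross-shift = AllPairs.map⁺ ∘ AllPairs.map λ (i<i′ , j<j′ , i′≤j) → i<i′ , s<s j<j′ , i′≤j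

cross-unshift : ∀ {v} → Cross 0 v → Cross 1 (map (map₂ pred) v)
cross-unshift = AllPairs.map⁺ ∘ AllPairs.map λ
  { {_ , suc _} {_ , suc _} (i<i′ , j<j′ , i′<j) → i<i′ , s<s⁻¹ j<j′ , i′<j }

module _ {P Q : List Arc → Set} (P? : Decidable P) (Q? : Decidable Q)
         (detectsP : Detects 0 P) (detectsQ : Detects 1 Q) {k} (2≤k : 2 ≤ k) where

  -- By `cross-length` no arc of a crossing is skipped, so shifting right endpoints matches
  -- crossings with enhanced crossings. The block lost by the reduction is the factor `t`.
  weight-reduce : ∀ b {as′ as} → Reduces as′ as → ∀ ℓ →
    weight P? k (suc b) as′ (suc ℓ) ≡ weight Q? k b as ℓ
  weight-reduce b red ℓ = weight-cong P? Q? k (suc b) b (suc ℓ) ℓ (mk⇔ suc-injective (cong suc))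
    (any-seqs k λ { v refl v⊆ Pv →
      let c = to (detectsP v 2≤k) Pv in
      map (map₂ pred) v , length-map _ v ,
      All.map⁺ (All.zipWith (λ (a∈ , i<j) → reduces-∈ red a∈ i<j) (v⊆ , cross-length 0 v 2≤k c)) ,
      from (detectsQ _ (subst (2 ≤_) (sym (length-map _ v)) 2≤k)) (cross-unshift c) })
    (any-seqs k λ { v refl v⊆ Qv →
      map (map₂ suc) v , length-map _ v ,
      All.map⁺ (All.map (reduces-∈⁻ red) v⊆) ,
      from (detectsP _ (subst (2 ≤_) (sym (length-map _ v)) 2≤k))
           (cross-shift (to (detectsQ v 2≤k) Qv)) })

-- Restricted growth strings

-- The part of the enumeration in `partitions` that continues one given string by `r` labels,
-- arranged node by node like `growths`.
extensions : (List ℕ × ℕ → ℕ) → ℕ → List ℕ × ℕ → ℕ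
extensions G zero    sb      = G sb
extensions G (suc r) (s , b) =
  ∑ (upTo (suc b)) (λ a → extensions G r (s ∷ʳ a , b ⊔ suc a))

∑-extensions : ∀ G r m → ∑ (partitions m) (extensions G r) ≡ ∑ (partitions (r + m)) G
∑-extensions G zero    m = refl
∑-extensions G (suc r) m = begin
  ∑ (partitions m) (extensions G (suc r))
    ≡⟨ ∑-cong (All.universal (λ (s , b) →
         sym (∑-map (λ a → s ∷ʳ a , b ⊔ suc a) (extensions G r) (upTo (suc b)))) (partitions m)) ⟩
  ∑ (partitions m) (λ (s , b) →
      ∑ (map (λ a → s ∷ʳ a , b ⊔ suc a) (upTo (suc b))) (extensions G r))
    ≡⟨ ∑-concatMap _ (extensions G r) (partitions m) ⟨
  ∑ (partitions (suc m)) (extensions G r)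
    ≡⟨ ∑-extensions G r (suc m) ⟩
  ∑ (partitions (r + suc m)) G
    ≡⟨ cong (λ x → ∑ (partitions x) G) (+-suc r m) ⟩
  ∑ (partitions (suc r + m)) G ∎
  where open ≡-Reasoning

lab-∷ʳ-≤ : ∀ s a {l} → l ≤ length s → lab (s ∷ʳ a) l ≡ lab s l
lab-∷ʳ-≤ []      a {zero}        _         = refl
lab-∷ʳ-≤ (x ∷ s) a {zero}        _         = refl
lab-∷ʳ-≤ (x ∷ s) a {suc zero}    _         = refl
lab-∷ʳ-≤ (x ∷ s) a {suc (suc l)} (s≤s l≤) = lab-∷ʳ-≤ s a l≤

lab-∷ʳ-last : ∀ s a → lab (s ∷ʳ a) (suc (length s)) ≡ a
lab-∷ʳ-last []      a = refl
lab-∷ʳ-last (x ∷ s) a = lab-∷ʳ-last s a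

-- Loops are left out. The bound `1 ≤ i` excludes position 0, where `lab` returns a default value.
ProperArc : List ℕ → ℕ → ℕ → Set
ProperArc s i j =
  1 ≤ i × i < j × lab s i ≡ lab s j × (∀ {l} → i < l → l < j → lab s l ≢ lab s i)

properArc-resp : ∀ s s′ {i j} → (∀ {l} → l ≤ j → lab s l ≡ lab s′ l) →
  ProperArc s i j → ProperArc s′ i j
properArc-resp s s′ agree (1≤i , i<j , i~j , between) =
  1≤i , i<j , trans (sym (agree (<⇒≤ i<j))) (trans i~j (agree ≤-refl)) ,
  λ i<l l<j l~i → between i<l l<j
    (trans (agree (<⇒≤ l<j)) (trans l~i (sym (agree (<⇒≤ i<j)))))

IsEnd : ℕ → List ℕ → ℕ → Set
IsEnd p s e = 1 ≤ e × e ≤ p × (∀ {l} → e < l → l ≤ p → lab s l ≢ lab s e)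

-- The invariant tying a string to its grown arcs. By `labels` each block has exactly one listed
-- end, so choosing an old label is choosing an end. Arcs are matched by membership, which is all
-- that crossings depend on.
record State (p : ℕ) (s : List ℕ) (b : ℕ) (as : List Arc) (ends : List ℕ) : Set where
  field
    length≡ : length s ≡ p
    lab<b   : ∀ {l} → 1 ≤ l → l ≤ p → lab s l < b
    labels  : map (lab s) ends ↭ upTo b
    isEnd   : All (IsEnd p s) ends
    arcs⇔   : ∀ {i j} → (i , j) ∈ as ⇔ (j ≤ p × ProperArc s i j)

state-[] : State 0 [] 0 [] []
state-[] = record
  { length≡ = refl
  ; lab<b   = λ { {zero} () _ ; {suc _} _ () }
  ; labels  = ↭-refl
  ; isEnd   = []
  ; arcs⇔   = mk⇔ (λ ()) (λ { (z≤n , _ , () , _) })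
  }

module _ {s b as ends} (st : State (length s) s b as ends) where
  open State st

  private
    p = length s

    agree : ∀ {a l} → l ≤ p → lab (s ∷ʳ a) l ≡ lab s l
    agree = lab-∷ʳ-≤ s _

    new : ∀ {a} → lab (s ∷ʳ a) (suc p) ≡ a
    new = lab-∷ʳ-last s _

    length′ : ∀ {a} → length (s ∷ʳ a) ≡ suc p
    length′ = trans (length-++ s) (+-comm p 1)

    lab<b′ : ∀ {a b′} → a < b′ → b ≤ b′ → ∀ {l} → 1 ≤ l → l ≤ suc p → lab (s ∷ʳ a) l < b′
    lab<b′ a<b′ b≤b′ 1≤l l≤ with m≤n⇒m<n∨m≡n l≤
    ... | inj₁ (s≤s l≤p) = subst (_< _) (sym (agree l≤p)) (<-≤-trans (lab<b 1≤l l≤p) b≤b′)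
    ... | inj₂ refl      = subst (_< _) (sym new) a<b′

    labels′ : ∀ {a xs} → All (IsEnd p s) xs →
      map (lab (s ∷ʳ a)) (suc p ∷ xs) ≡ a ∷ map (lab s) xs
    labels′ xs-ends = cong₂ _∷_ new (map-cong-local (All.map (λ (_ , e≤p , _) → agree e≤p) xs-ends))

    isEnd-new : ∀ {a} → IsEnd (suc p) (s ∷ʳ a) (suc p)
    isEnd-new = s≤s z≤n , ≤-refl , λ p<l l≤p → contradiction l≤p (<⇒≱ p<l)

    isEnd-old : ∀ {a e} → lab s e ≢ a → IsEnd p s e → IsEnd (suc p) (s ∷ʳ a) e
    isEnd-old {a} {e} e≁a (1≤e , e≤p , after) = 1≤e , m≤n⇒m≤1+n e≤p , after′
      where
      after′ : ∀ {l} → e < l → l ≤ suc p → lab (s ∷ʳ a) l ≢ lab (s ∷ʳ a) e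
      after′ e<l l≤ l~e with m≤n⇒m<n∨m≡n l≤
      ... | inj₁ (s≤s l≤p) = after e<l l≤p (trans (sym (agree l≤p)) (trans l~e (agree e≤p)))
      ... | inj₂ refl      = e≁a (trans (sym (agree e≤p)) (trans (sym l~e) new))

    old-arc : ∀ {a i j} → (i , j) ∈ as → j ≤ suc p × ProperArc (s ∷ʳ a) i j
    old-arc a∈ with j≤p , arc ← to arcs⇔ a∈ =
      m≤n⇒m≤1+n j≤p , properArc-resp s (s ∷ʳ _) (λ l≤j → sym (agree (≤-trans l≤j j≤p))) arc

    old-arc⁻ : ∀ {a i j} → j ≤ p → ProperArc (s ∷ʳ a) i j → (i , j) ∈ as
    old-arc⁻ j≤p arc = from arcs⇔ (j≤p , properArc-resp (s ∷ʳ _) s (λ l≤j → agree (≤-trans l≤j j≤p)) arc)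

    new-arc-label : ∀ {a i} → ProperArc (s ∷ʳ a) i (suc p) → lab s i ≡ a
    new-arc-label (_ , s≤s i≤p , i~ , _) = trans (sym (agree i≤p)) (trans i~ new)

  -- All earlier labels are below `b`, so no arc reaches the new node and no old end is lost.
  state-open : State (suc p) (s ∷ʳ b) (suc b) as (suc p ∷ ends)
  state-open = record
    { length≡ = length′
    ; lab<b   = lab<b′ (n<1+n b) (n≤1+n b)
    ; labels  = subst₂ _↭_ (sym (labels′ isEnd)) (upTo-∷ʳ b)
                  (↭-trans (prep b labels) (∷↭∷ʳ b (upTo b)))
    ; isEnd   = isEnd-new ∷ All.map (λ end@(1≤e , e≤p , _) → isEnd-old (<⇒≢ (lab<b 1≤e e≤p)) end) isEnd
    ; arcs⇔   = mk⇔ old-arc (λ (j≤ , arc) → arc⁻ j≤ arc)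
    }
    where
    arc⁻ : ∀ {i j} → j ≤ suc p → ProperArc (s ∷ʳ b) i j → (i , j) ∈ as
    arc⁻ j≤ arc with m≤n⇒m<n∨m≡n j≤
    ... | inj₁ (s≤s j≤p) = old-arc⁻ j≤p arc
    arc⁻ j≤ arc@(1≤i , s≤s i≤p , _) | inj₂ refl =
      contradiction (new-arc-label arc) (<⇒≢ (lab<b 1≤i i≤p))

  -- The other ends carry labels different from that of `e`, so they stay ends, while `suc p`
  -- replaces `e`.
  state-join : ∀ {e rest} → e ∷ rest ↭ ends →
    State (suc p) (s ∷ʳ lab s e) b ((e , suc p) ∷ as) (suc p ∷ rest)
  state-join {e} {rest} e∷rest↭ends
    with e-end@(1≤e , e≤p , after) ∷ rest-ends ← All-resp-↭ (↭-sym e∷rest↭ends) isEnd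
    with labels↭ ← ↭-trans (↭-map⁺ (lab s) e∷rest↭ends) labels
    -- Distinctness of the labels at the ends is inherited from `upTo b`.
    with e≁rest ∷ _ ← Unique-resp-↭ (setoid ℕ) (↭⇒↭ₛ (↭-sym labels↭)) (upTo⁺ b)
    = record
    { length≡ = length′
    ; lab<b   = lab<b′ (lab<b 1≤e e≤p) ≤-refl
    ; labels  = subst (_↭ upTo b) (sym (labels′ rest-ends)) labels↭
    ; isEnd   = isEnd-new ∷ All.zipWith (λ (≁e , end) → isEnd-old (≢-sym ≁e) end)
                                        (All.map⁻ e≁rest , rest-ends)
    ; arcs⇔   = mk⇔
        (λ { (here refl) → ≤-refl , 1≤e , s≤s e≤p , trans (agree e≤p) (sym new) ,
               λ { e<l (s≤s l≤p) l~e →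
                 after e<l l≤p (trans (sym (agree l≤p)) (trans l~e (agree e≤p))) }
           ; (there a∈)  → old-arc a∈ })
        (λ (j≤ , arc) → arc⁻ j≤ arc)
    }
    where
    arc⁻ : ∀ {i j} → j ≤ suc p → ProperArc (s ∷ʳ lab s e) i j → (i , j) ∈ (e , suc p) ∷ as
    arc⁻ j≤ arc with m≤n⇒m<n∨m≡n j≤
    ... | inj₁ (s≤s j≤p) = there (old-arc⁻ j≤p arc)
    -- An arc into the new node starts at `e`: from an earlier node it would pass over `e`, and a
    -- later node of that block would contradict that `e` is its end.
    arc⁻ {i} j≤ arc@(1≤i , s≤s i≤p , _ , between) | inj₂ refl with <-cmp i e
    ... | tri≈ _ refl _ = here refl
    ... | tri< i<e _ _  = contradiction
            (trans (agree e≤p) (trans (sym (new-arc-label arc)) (sym (agree i≤p))))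
            (between i<e (s≤s e≤p))
    ... | tri> _ _ e<i  = contradiction (new-arc-label arc) (after e<i i≤p)

module _ {G : List ℕ × ℕ → ℕ} {F : List Arc → ℕ → ℕ} {m}
         (G≡F : ∀ {s b as ends} → State m s b as ends → G (s , b) ≡ F as (length ends)) where

  -- The label `b` opens a block, and a label below `b` joins the block with that label, hence its
  -- unique end.
  extensions-growths : ∀ r {p s b as ends} → r + p ≡ m → State p s b as ends →
    extensions G r (s , b) ≡ growths F r p as ends
  extensions-growths zero    refl st = G≡F st
  extensions-growths (suc r) {p} {s} {b} {as} {ends} r+p≡m st with refl ← State.length≡ st = begin
    ∑ (upTo (suc b)) g                          ≡⟨ ∑-upTo-∷ʳ b g ⟩
    ∑ (upTo b) g + g b                          ≡⟨ +-comm (∑ (upTo b) g) (g b) ⟩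
    -- The labels below `b` are listed in the order of `ends`, as `growths` runs through the ends.
    g b + ∑ (upTo b) g                          ≡⟨ cong (g b +_) (sum-↭ (↭-map⁺ g labels)) ⟨
    g b + ∑ (map (lab s) ends) g                ≡⟨ cong (g b +_) (∑-map (lab s) g ends) ⟩
    g b + ∑ ends (g ∘ lab s)                    ≡⟨ cong (λ xs → g b + ∑ xs (g ∘ lab s)) (map-proj₁-select ends) ⟨
    g b + ∑ (map proj₁ (select ends)) (g ∘ lab s) ≡⟨ cong (g b +_) (∑-map proj₁ (g ∘ lab s) (select ends)) ⟩
    g b + ∑ (select ends) (g ∘ lab s ∘ proj₁)
      ≡⟨ cong₂ _+_
          (trans (g≡ (m≤n⇒m⊔n≡n (n≤1+n b))) (extensions-growths r r+1+p≡m (state-open st)))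
          (∑-cong (All.map (λ { {e , rest} e∷rest↭ends →
             case All-resp-↭ (↭-sym e∷rest↭ends) isEnd of λ { ((1≤e , e≤p , _) ∷ _) →
               -- An old label leaves the number of blocks at `b`.
               trans (g≡ (m≥n⇒m⊔n≡m (lab<b 1≤e e≤p)))
                     (extensions-growths r r+1+p≡m (state-join st e∷rest↭ends)) } })
             (select-↭ ends))) ⟩
    growths F (suc r) p as ends ∎
    where
    open ≡-Reasoning
    open State st
    g : ℕ → ℕ
    g a = extensions G r (s ∷ʳ a , b ⊔ suc a)
    g≡ : ∀ {a c} → b ⊔ suc a ≡ c → g a ≡ extensions G r (s ∷ʳ a , c)
    g≡ refl = refl
    r+1+p≡m = trans (+-suc r p) r+p≡m

-- Arc diagrams and the counting polynomials.

∈-nodes⁺ : ∀ {m l} → 1 ≤ l → l ≤ m → l ∈ nodes m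
∈-nodes⁺ {l = suc l} _ l<m = ∈-map⁺ suc (∈-upTo⁺ l<m)

∈-nodes⁻ : ∀ {m l} → l ∈ nodes m → 1 ≤ l × l ≤ m
∈-nodes⁻ l∈ with x , x∈ , refl ← ∈-map⁻ suc l∈ = s≤s z≤n , ∈-upTo⁻ x∈

∈-arcs⁻ : ∀ m s {i j} → (i , j) ∈ arcs m s → i < j → j ≤ m × ProperArc s i j
∈-arcs⁻ m s {i} {j} a∈ i<j
  with ij∈ , arc ← ∈-filter⁻ (isArc? m s) {xs = cartesianProduct (nodes m) (nodes m)} a∈
  with i∈ , j∈ ← ∈-cartesianProduct⁻ (nodes m) (nodes m) ij∈
  with 1≤i , _ ← ∈-nodes⁻ i∈ | _ , j≤m ← ∈-nodes⁻ j∈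
  with arc
... | inj₂ (refl , _) = contradiction i<j (<-irrefl refl)
... | inj₁ (_ , i~j , between) = j≤m , 1≤i , i<j , i~j , λ i<l l<j →
        All.lookup between
          (∈-nodes⁺ (≤-trans 1≤i (<⇒≤ i<l)) (≤-trans (<⇒≤ l<j) j≤m)) i<l l<j

∈-arcs⁺ : ∀ m s {i j} → j ≤ m → ProperArc s i j → (i , j) ∈ arcs m s
∈-arcs⁺ m s j≤m (1≤i , i<j , i~j , between) = ∈-filter⁺ (isArc? m s)
  (∈-cartesianProduct⁺ (∈-nodes⁺ 1≤i (≤-trans (<⇒≤ i<j) j≤m)) (∈-nodes⁺ (≤-trans 1≤i (<⇒≤ i<j)) j≤m))
  (inj₁ (i<j , i~j , All.tabulate (λ _ i<l l<j → between i<l l<j)))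

module _ {P : List Arc → Set} (P? : Decidable P) {d} (detects : Detects d P) (d≤1 : d ≤ 1)
         {k} (2≤k : 2 ≤ k) where

  -- `arcs m s` also lists a loop for each singleton block. Since `d ≤ 1`, `cross-length` gives
  -- `i < j` for every arc of a detected crossing, so all of them are among the grown arcs.
  count-growths : ∀ m b →
    length (filter (λ sb → (proj₂ sb ≟ b) ×-dec ¬? (any? P? (seqs k (arcs m (proj₁ sb)))))
                   (partitions m)) ≡
    growths (weight P? k b) m 0 [] []
  count-growths m b = begin
    _                                  ≡⟨ length-filter-∑ _ (partitions m) ⟩
    ∑ (partitions m) G                 ≡⟨ cong (λ x → ∑ (partitions x) G) (+-identityʳ m) ⟨
    ∑ (partitions (m + 0)) G           ≡⟨ ∑-extensions G m 0 ⟨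
    extensions G m ([] , 0) + 0        ≡⟨ +-identityʳ _ ⟩
    extensions G m ([] , 0)            ≡⟨ extensions-growths G≡weight m (+-identityʳ m) state-[] ⟩
    growths (weight P? k b) m 0 [] []  ∎
    where
    open ≡-Reasoning
    G : List ℕ × ℕ → ℕ
    G (s , c) = weight P? k b (arcs m s) c

    G≡weight : ∀ {s c as ends} → State m s c as ends → G (s , c) ≡ weight P? k b as (length ends)
    G≡weight {s} {c} {as} {ends} st = weight-cong P? P? k b b c (length ends)
      (mk⇔ (trans |ends|≡c) (trans (sym |ends|≡c)))
      (any-seqs k λ { v refl v⊆ Pv → v , refl ,
        All.zipWith (λ (a∈ , i<j) →
          from arcs⇔ (∈-arcs⁻ m s a∈ (≤-pred (<-≤-trans i<j (+-monoˡ-≤ _ d≤1)))))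
          (v⊆ , cross-length d v 2≤k (to (detects v 2≤k) Pv)) , Pv })
      (any-seqs k λ v |v|≡k v⊆ Pv → v , |v|≡k ,
        All.map (λ a∈ → let j≤m , arc = to arcs⇔ a∈ in ∈-arcs⁺ m s j≤m arc) v⊆ , Pv)
      where
      open State st
      |ends|≡c : length ends ≡ c
      |ends|≡c = trans (sym (length-map (lab s) ends)) (trans (↭-length labels) (length-upTo c))

NC-growths : ∀ m {k} → 2 ≤ k → ∀ b → NC m k b ≡ growths (weight isCrossing? k b) m 0 [] []
NC-growths m 2≤k = count-growths isCrossing? crossing⇔ z≤n 2≤k m

enhanced? : Decidable (λ v → IsCrossing v ⊎ IsWeakCrossing v)
enhanced? v = isCrossing? v ⊎-dec isWeakCrossing? v

NW-growths : ∀ m {k} → 2 ≤ k → ∀ b → NW m k b ≡ growths (weight enhanced? k b) m 0 [] []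
NW-growths m 2≤k = count-growths enhanced? enhanced⇔ ≤-refl 2≤k m

partitions-nonempty : ∀ m → All (λ sb → proj₂ sb ≢ 0) (partitions (suc m))
partitions-nonempty m = All.concat⁺ (All.map⁺ (All.universal
  (λ (s , b) → All.map⁺ (All.universal (λ a b⊔1+a≡0 → 1+n≢0 (n≤0⇒n≡0 (subst (suc a ≤_) b⊔1+a≡0 (m≤n⊔m b (suc a))))) _))
  (partitions m)))

theorem1p1 : (n k : ℕ) → 1 ≤ n → 2 ≤ k →
    (b : ℕ) → NC (suc n) k b ≡ tmul (binomNWSum n k) b
-- The factor `t` makes the right side 0, and a partition of a nonempty set has a block.
theorem1p1 n k _ 2≤k zero = cong length (filter-none
  (λ sb → (proj₂ sb ≟ 0) ×-dec ¬? (hasCrossing? k (suc n) (proj₁ sb)))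
  (All.map (λ b≢0 (b≡0 , _) → b≢0 b≡0) (partitions-nonempty n)))
theorem1p1 n k _ 2≤k (suc b) = begin
  NC (suc n) k (suc b)
    ≡⟨ NC-growths (suc n) 2≤k (suc b) ⟩
  -- Node 1 can only open a block; the `0` is the empty sum over blocks to join. Now the left side
  -- is one node ahead, as `growths-reduce` requires.
  growths crossWeight n 1 [] (1 ∷ []) + 0
    ≡⟨ +-identityʳ _ ⟩
  growths crossWeight n 1 [] (1 ∷ [])
    ≡⟨ growths-reduce crossWeight enhancedWeight
         (weight-reduce isCrossing? enhanced? crossing⇔ enhanced⇔ 2≤k b)
         (weight-relabel enhanced? enhanced⇔ 2≤k b) n [] [] [] ⟩
  binomialSum n (λ i → growths enhancedWeight i 0 [] [])
    ≡⟨ binomialSum-cong n (λ i → NW-growths i 2≤k b) ⟨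
  binomialSum n (λ i → NW i k b)
    ≡⟨ binomialSum-∑C n (λ i → NW i k b) ⟨
  binomNWSum n k b ∎
  where
  open ≡-Reasoning
  crossWeight enhancedWeight : List Arc → ℕ → ℕ
  crossWeight    = weight isCrossing? k (suc b)
  enhancedWeight = weight enhanced? k b
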